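{- Let $f:\mathbb{N}^k\to\mathbb{N}$ be a function in the class $\mathcal{G}$. Then for all but finitely many positive integers $s$ there exists a $\lambda$-term $E$ such that (1) for all $n_1,\dots,n_k\in\mathbb{N}$, $E\,\rho(n_1)\cdots\rho(n_k)=_{\beta\eta}\rho(f(n_1,\dots,n_k))$, and (2) $\vdash E:\omega_{\tau(s)}\to\cdots\to\omega_{\tau(s)}\to\omega_{\tau(s)}$ (with $k$ arguments), where $\tau(s)=(\alpha^{s}\to\alpha)\to\alpha$ with $\alpha=\omega_o$, i.e. $\tau(s)$ is the type of an $s$-tuple of numerals.
   Context: We work in the simply typed $\lambda$-calculus (type assignment to untyped $\lambda$-terms) with a single base type $o$. For a type $\tau$, $\omega_\tau=(\tau\to\tau)\to\tau\to\tau$, and $\beta_1^{s}\to\gamma$ abbreviates $\beta_1\to\cdots\to\beta_1\to\gamma$ with $s$ copies of $\beta_1$. The Church numeral of $n$ is $\rho(n)=\lambda f x.f^{n}x$ (so $\rho(0)=\lambda fx.x$, $\rho(1)=\lambda fx.fx$, etc.); it can be assigned type $\omega_\tau$ for every $\tau$. Equality $=_{\beta\eta}$ is $\beta\eta$-conversion. Extended polynomials: the smallest class of functions over $\mathbb{N}$ containing the constants $0$ and $1$, projections, addition, multiplication and $\mathrm{ifzero}(n,m,p)=(\text{if } n=0 \text{ then } m \text{ else } p)$, closed under composition. $\mathcal{G}$ is the smallest class of functions over $\mathbb{N}$ that is closed under composition and contains: all extended polynomials; for every $l\geq 2$ the function $f_1^{l}(m,n_1,\dots,n_l)=n_i$ where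 $i=(m\bmod l)+1$; and for every $l\geq 1$ the function $f_2^{l}(m,n_1,n_2)=(\text{if } m\leq l \text{ then } n_1 \text{ else } n_2)$. -}

module Defs where

open import Data.Bool using (if_then_else_)
open import Data.Fin using (Fin; zero; suc)
open import Data.Nat using (ℕ; zero; suc; _+_; _*_; _≤_; _≤ᵇ_; NonTrivial; nonTrivial⇒nonZero)
open import Data.Nat.DivMod using (_mod_)
open import Data.Nat.GeneralisedArithmetic using (fold)
open import Data.Vec using (Vec; []; _∷_; lookup; tabulate)
open import Relation.Binary.Construct.Closure.Equivalence using (EqClosure)
open import Relation.Binary.PropositionalEquality using (_≗_)

infixl 7 _·_ _·*_
infix  4 _⟶_ _=βη_ _⊢_∶_
infixr 5 _⇒_ _^_⇒_
infix  6 ƛ_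

-- Untyped λ-terms with at most n free variables, in de Bruijn notation.
data Term (n : ℕ) : Set where
  var : Fin n → Term n
  ƛ_  : Term (suc n) → Term n
  _·_ : Term n → Term n → Term n

_·*_ : ∀ {n k} → Term n → Vec (Term n) k → Term n
M ·* []       = M
M ·* (N ∷ Ns) = (M · N) ·* Ns

ext : ∀ {m n} → (Fin m → Fin n) → Fin (suc m) → Fin (suc n)
ext r zero    = zero
ext r (suc i) = suc (r i)

rename : ∀ {m n} → (Fin m → Fin n) → Term m → Term n
rename r (var i) = var (r i)
rename r (ƛ M)   = ƛ (rename (ext r) M)
rename r (M · N) = rename r M · rename r N

weaken : ∀ {n} → Term n → Term (suc n)
weaken = rename suc

exts : ∀ {m n} → (Fin m → Term n) → Fin (suc m) → Term (suc n)
exts σ zero    = var zero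
exts σ (suc i) = weaken (σ i)

subst : ∀ {m n} → (Fin m → Term n) → Term m → Term n
subst σ (var i) = σ i
subst σ (ƛ M)   = ƛ (subst (exts σ) M)
subst σ (M · N) = subst σ M · subst σ N

single : ∀ {n} → Term n → Fin (suc n) → Term n
single N zero    = N
single N (suc i) = var i

_[_] : ∀ {n} → Term (suc n) → Term n → Term n
M [ N ] = subst (single N) M

data _⟶_ {n : ℕ} : Term n → Term n → Set where
  β  : ∀ {M N} → (ƛ M) · N ⟶ M [ N ]
  η  : ∀ {M} → ƛ (weaken M · var zero) ⟶ M
  ξ  : ∀ {M M′ : Term (suc n)} → M ⟶ M′ → ƛ M ⟶ ƛ M′
  ·ˡ : ∀ {M M′ N} → M ⟶ M′ → M · N ⟶ M′ · N
  ·ʳ : ∀ {M N N′} → N ⟶ N′ → M · N ⟶ M · N′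

_=βη_ : ∀ {n} → Term n → Term n → Set
_=βη_ = EqClosure _⟶_

ρ : ℕ → Term 0
ρ n = ƛ ƛ fold (var zero) (var (suc zero) ·_) n

data Type : Set where
  o   : Type
  _⇒_ : Type → Type → Type

_^_⇒_ : Type → ℕ → Type → Type
σ ^ s ⇒ γ = fold γ (σ ⇒_) s

ω : Type → Type
ω σ = (σ ⇒ σ) ⇒ σ ⇒ σ

α : Type
α = ω o

τ : ℕ → Type
τ s = (α ^ s ⇒ α) ⇒ α

data _⊢_∶_ {n : ℕ} (Γ : Vec Type n) : Term n → Type → Set where
  ⊢var : ∀ i → Γ ⊢ var i ∶ lookup Γ i
  ⊢ƛ   : ∀ {M σ γ} → (σ ∷ Γ) ⊢ M ∶ γ → Γ ⊢ ƛ M ∶ σ ⇒ γ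
  ⊢·   : ∀ {M N σ γ} → Γ ⊢ M ∶ σ ⇒ γ → Γ ⊢ N ∶ σ → Γ ⊢ M · N ∶ γ

compose : ∀ {m k} → (Vec ℕ m → ℕ) → (Fin m → Vec ℕ k → ℕ) → Vec ℕ k → ℕ
compose f g ns = f (tabulate λ i → g i ns)

add mul : Vec ℕ 2 → ℕ
add (m ∷ n ∷ []) = m + n
mul (m ∷ n ∷ []) = m * n

ifzero : Vec ℕ 3 → ℕ
ifzero (zero  ∷ m ∷ p ∷ []) = m
ifzero (suc _ ∷ m ∷ p ∷ []) = p

-- The constructors named ≗-closed, here and in 𝒢, make these classes of
-- functions in the extensional sense, as Agda lacks function extensionality.
data ExtendedPolynomial : ∀ {k} → (Vec ℕ k → ℕ) → Set where
  const-0  : ∀ {k} → ExtendedPolynomial {k} (λ _ → 0)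
  const-1  : ∀ {k} → ExtendedPolynomial {k} (λ _ → 1)
  proj     : ∀ {k} (i : Fin k) → ExtendedPolynomial (λ ns → lookup ns i)
  addition : ExtendedPolynomial add
  multiplication : ExtendedPolynomial mul
  conditional    : ExtendedPolynomial ifzero
  composition    : ∀ {m k} {f : Vec ℕ m → ℕ} {g : Fin m → Vec ℕ k → ℕ} →
                   ExtendedPolynomial f → (∀ i → ExtendedPolynomial (g i)) →
                   ExtendedPolynomial (compose f g)
  ≗-closed : ∀ {k} {f g : Vec ℕ k → ℕ} → f ≗ g →
             ExtendedPolynomial f → ExtendedPolynomial g

-- n_i with i = (m mod l) + 1 counted from 1 is entry m mod l counted from 0.
f₁ : ∀ l → .{{NonTrivial l}} → Vec ℕ (suc l) → ℕ
f₁ l (m ∷ ns) = lookup ns (_mod_ m l {{nonTrivial⇒nonZero l}})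

f₂ : ℕ → Vec ℕ 3 → ℕ
f₂ l (m ∷ n₁ ∷ n₂ ∷ []) = if m ≤ᵇ l then n₁ else n₂

data 𝒢 : ∀ {k} → (Vec ℕ k → ℕ) → Set where
  extendedPolynomial : ∀ {k} {f : Vec ℕ k → ℕ} → ExtendedPolynomial f → 𝒢 f
  residue     : ∀ l → .{{_ : NonTrivial l}} → 𝒢 (f₁ l)
  threshold   : ∀ l → 1 ≤ l → 𝒢 (f₂ l)
  composition : ∀ {m k} {f : Vec ℕ m → ℕ} {g : Fin m → Vec ℕ k → ℕ} →
                𝒢 f → (∀ i → 𝒢 (g i)) → 𝒢 (compose f g)
  ≗-closed    : ∀ {k} {f g : Vec ℕ k → ℕ} → f ≗ g → 𝒢 f → 𝒢 g

{-# OPTIONS --safe #-}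
module Submission where

-- Terms are built in open form: a term with one free variable of type ω (τ s)
-- per argument, so that composition of functions is substitution.  Apart from
-- the arithmetic of Church numerals, one construction suffices: branching on
-- p m for an eventually periodic p.  Iterating m on s-tuples, the tuple
-- (p 0, …, p (s - 1)) is turned into (p m, …, p (m + s - 1)) as soon as s is at
-- least the sum of period and preperiod: each step shifts the entries, the
-- new last one being read off one period earlier.  Its first entry p m, a numeral
-- of type α, then chooses at type o between the two η-expanded branches.

open import Defs
open import Data.Bool using (T; true; false; if_then_else_)
open import Data.Fin using (Fin; zero; suc; toℕ; fromℕ<; _≟_)
open import Data.Fin.Properties using (toℕ-fromℕ<; fromℕ<-cong; toℕ<n)
open import Data.List using (List; []; _∷_; upTo; allFin)
open import Data.List.Membership.Propositional using (_∈_; _∉_)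
open import Data.List.Membership.Propositional.Properties using (∈-upTo⁺; ∈-allFin)
open import Data.List.Relation.Unary.Any using (here; there)
open import Data.Nat using (ℕ; zero; suc; _+_; _*_; _∸_; _≤_; _<_; _≤ᵇ_; _⊔_; _<?_; s≤s; z≤n; NonZero; NonTrivial; nonTrivial⇒nonZero; ≢-nonZero⁻¹)
open import Data.Nat.DivMod using (_mod_; _%_; [m+n]%n≡m%n)
open import Data.Nat.GeneralisedArithmetic using (fold; fold-+)
open import Data.Nat.Properties hiding (_≟_)
open import Data.Product using (Σ-syntax; _×_; _,_)
open import Data.Sum using (_⊎_; inj₁; inj₂; [_,_]′)
open import Data.Vec using (Vec; []; _∷_; lookup; map; replicate; tabulate)
open import Data.Vec.Properties using (lookup-map; lookup-replicate; lookup∘tabulate)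
open import Function using (_∘_; const)
import Relation.Binary.Construct.Closure.Equivalence as EqClosure
open import Relation.Binary.Construct.Closure.ReflexiveTransitive using (ε; _◅◅_)
open import Relation.Binary.PropositionalEquality as ≡ using (_≡_; _≗_; refl; sym; trans; cong; cong₂)
open import Relation.Nullary using (does; yes; no; contradiction)
import Relation.Binary.Reasoning.Setoid as SetoidReasoning

private variable
  k l m n s : ℕ

-- Substitution

infixr 5 _•_

_•_ : Term n → (Fin m → Term n) → Fin (suc m) → Term n
(N • σ) zero    = N
(N • σ) (suc i) = σ i

ext-cong : {r r′ : Fin m → Fin n} → r ≗ r′ → ext r ≗ ext r′
ext-cong e zero    = refl
ext-cong e (suc i) = cong suc (e i)

rename-cong : {r r′ : Fin m → Fin n} → r ≗ r′ → rename r ≗ rename r′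
rename-cong e (var i) = cong var (e i)
rename-cong e (ƛ M)   = cong ƛ_ (rename-cong (ext-cong e) M)
rename-cong e (M · N) = cong₂ _·_ (rename-cong e M) (rename-cong e N)

exts-cong : {σ σ′ : Fin m → Term n} → σ ≗ σ′ → exts σ ≗ exts σ′
exts-cong e zero    = refl
exts-cong e (suc i) = cong weaken (e i)

subst-cong : {σ σ′ : Fin m → Term n} → σ ≗ σ′ → subst σ ≗ subst σ′
subst-cong e (var i) = e i
subst-cong e (ƛ M)   = cong ƛ_ (subst-cong (exts-cong e) M)
subst-cong e (M · N) = cong₂ _·_ (subst-cong e M) (subst-cong e N)

rename-rename : (r′ : Fin m → Fin n) (r : Fin l → Fin m) →
                rename r′ ∘ rename r ≗ rename (r′ ∘ r)
rename-rename r′ r (var i) = refl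
rename-rename r′ r (ƛ M)   = cong ƛ_ (trans (rename-rename (ext r′) (ext r) M)
  (rename-cong (λ { zero → refl ; (suc i) → refl }) M))
rename-rename r′ r (M · N) = cong₂ _·_ (rename-rename r′ r M) (rename-rename r′ r N)

subst-rename : (σ : Fin m → Term n) (r : Fin l → Fin m) →
               subst σ ∘ rename r ≗ subst (σ ∘ r)
subst-rename σ r (var i) = refl
subst-rename σ r (ƛ M)   = cong ƛ_ (trans (subst-rename (exts σ) (ext r) M)
  (subst-cong (λ { zero → refl ; (suc i) → refl }) M))
subst-rename σ r (M · N) = cong₂ _·_ (subst-rename σ r M) (subst-rename σ r N)

rename-subst : (r : Fin m → Fin n) (σ : Fin l → Term m) →
               rename r ∘ subst σ ≗ subst (rename r ∘ σ)
rename-subst r σ (var i) = refl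
rename-subst r σ (ƛ M)   = cong ƛ_ (trans (rename-subst (ext r) (exts σ) M)
  (subst-cong (λ { zero    → refl
                 ; (suc i) → trans (rename-rename (ext r) suc (σ i))
                                   (sym (rename-rename suc r (σ i))) }) M))
rename-subst r σ (M · N) = cong₂ _·_ (rename-subst r σ M) (rename-subst r σ N)

subst-subst : (σ′ : Fin m → Term n) (σ : Fin l → Term m) →
              subst σ′ ∘ subst σ ≗ subst (subst σ′ ∘ σ)
subst-subst σ′ σ (var i) = refl
subst-subst σ′ σ (ƛ M)   = cong ƛ_ (trans (subst-subst (exts σ′) (exts σ) M)
  (subst-cong (λ { zero    → refl
                 ; (suc i) → trans (subst-rename (exts σ′) suc (σ i))
                                   (sym (rename-subst suc σ′ (σ i))) }) M))
subst-subst σ′ σ (M · N) = cong₂ _·_ (subst-subst σ′ σ M) (subst-subst σ′ σ N)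

subst-var : (M : Term n) → subst var M ≡ M
subst-var (var i) = refl
subst-var (ƛ M)   = cong ƛ_ (trans
  (subst-cong (λ { zero → refl ; (suc i) → refl }) M) (subst-var M))
subst-var (M · N) = cong₂ _·_ (subst-var M) (subst-var N)

weaken-[] : (M N : Term n) → weaken M [ N ] ≡ M
weaken-[] M N = trans (subst-rename (single N) suc M) (subst-var M)

-- The empty substitution is used because any two functions out of `Fin 0` agree pointwise: later
-- renamings and substitutions are thus absorbed.
lift : Term 0 → Term n
lift = subst λ ()

subst-lift : (σ : Fin m → Term n) (M : Term 0) → subst σ (lift M) ≡ lift M
subst-lift σ M = trans (subst-subst σ (λ ()) M) (subst-cong (λ ()) M)

rename-lift : (r : Fin m → Fin n) (M : Term 0) → rename r (lift M) ≡ lift M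
rename-lift r M = trans (rename-subst r (λ ()) M) (subst-cong (λ ()) M)

weaken-closed : (M : Term 0) → weaken M ≡ lift M
weaken-closed M = trans
  (cong weaken (trans (sym (subst-var M)) (subst-cong (λ ()) M))) (rename-lift suc M)

weaken²-closed : (M : Term 0) → weaken (weaken M) ≡ lift M
weaken²-closed M = trans (cong weaken (weaken-closed M)) (rename-lift suc M)

weaken³-closed : (M : Term 0) → weaken (weaken (weaken M)) ≡ lift M
weaken³-closed M = trans (cong weaken (weaken²-closed M)) (rename-lift suc M)

-- Conversion

module _ {n : ℕ} where
  open SetoidReasoning (EqClosure.setoid (_⟶_ {n})) public

≡⇒=βη : {M N : Term n} → M ≡ N → M =βη N
≡⇒=βη refl = ε

step : {M N : Term n} → M ⟶ N → M =βη N
step = EqClosure.return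

ƛ-cong : {M M′ : Term (suc n)} → M =βη M′ → ƛ M =βη ƛ M′
ƛ-cong = EqClosure.gmap ƛ_ ξ

·-congˡ : {M M′ N : Term n} → M =βη M′ → M · N =βη M′ · N
·-congˡ {N = N} = EqClosure.gmap (_· N) ·ˡ

·-congʳ : {M N N′ : Term n} → N =βη N′ → M · N =βη M · N′
·-congʳ {M = M} = EqClosure.gmap (M ·_) ·ʳ

-- The contraction is fused with the substitution pending on the body, so that successive β-steps
-- accumulate in one simultaneous substitution.
β-• : (σ : Fin m → Term n) (M : Term (suc m)) (N : Term n) →
      (ƛ subst (exts σ) M) · N =βη subst (N • σ) M
β-• σ M N = step β ◅◅ ≡⇒=βη (trans (subst-subst (single N) (exts σ) M)
  (subst-cong (λ { zero → refl ; (suc i) → weaken-[] (σ i) N }) M))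

-- Application to, and abstraction over, k arguments

apps : ∀ k → Term n → (Fin k → Term n) → Term n
apps zero    M a = M
apps (suc k) M a = apps k (M · a zero) (a ∘ suc)

-- Arguments given as a function let substitutions and conversions act pointwise; this equation
-- links them to the vectors of the theorem.
·*≡apps : (M : Term n) (Ns : Vec (Term n) k) → M ·* Ns ≡ apps k M (lookup Ns)
·*≡apps M []       = refl
·*≡apps M (N ∷ Ns) = ·*≡apps (M · N) Ns

apps-congˡ : ∀ k {M M′ : Term n} {a : Fin k → Term n} →
             M =βη M′ → apps k M a =βη apps k M′ a
apps-congˡ zero    e = e
apps-congˡ (suc k) e = apps-congˡ k (·-congˡ e)

apps-congʳ : ∀ k {M : Term n} {a a′ : Fin k → Term n} →
             (∀ i → a i =βη a′ i) → apps k M a =βη apps k M a′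
apps-congʳ zero    e = ε
apps-congʳ (suc k) e = apps-congˡ k (·-congʳ (e zero)) ◅◅ apps-congʳ k (e ∘ suc)

subst-apps : ∀ k (σ : Fin m → Term n) (M : Term m) (a : Fin k → Term m) →
             subst σ (apps k M a) ≡ apps k (subst σ M) (subst σ ∘ a)
subst-apps zero    σ M a = refl
subst-apps (suc k) σ M a = subst-apps k σ (M · a zero) (a ∘ suc)

-- Abstraction over k variables at once: v tells which variables of the body
-- are bound (and by which of the k abstractions, counted from the outside).
bind : (Fin m → Fin (suc k) ⊎ Fin n) → Fin m → Fin k ⊎ Fin (suc n)
bind v i with v i
... | inj₁ zero    = inj₂ zero
... | inj₁ (suc j) = inj₁ j
... | inj₂ j       = inj₂ (suc j)

lams : ∀ k → (Fin m → Fin k ⊎ Fin n) → Term m → Term n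
lams zero    v M = rename ([ (λ ()) , (λ j → j) ]′ ∘ v) M
lams (suc k) v M = ƛ lams k (bind v) M

-- The general `θ` makes the induction on `k` work: each β-step moves the first argument from `a` to
-- the front of `θ`, and `bind` makes the matching move in `v`.
lams-β : ∀ k (v : Fin m → Fin k ⊎ Fin n) (M : Term m) (θ : Fin n → Term l) (a : Fin k → Term l) →
         apps k (subst θ (lams k v M)) a =βη subst ([ a , θ ]′ ∘ v) M
lams-β zero v M θ a = ≡⇒=βη (trans (subst-rename θ _ M) (subst-cong agree M))
  where
  agree : ∀ i → θ ([ (λ ()) , (λ j → j) ]′ (v i)) ≡ [ a , θ ]′ (v i)
  agree i with v i
  ... | inj₂ j = refl
lams-β (suc k) v M θ a = begin
  apps k ((ƛ subst (exts θ) (lams k (bind v) M)) · a zero) (a ∘ suc)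
    ≈⟨ apps-congˡ k (β-• θ (lams k (bind v) M) (a zero)) ⟩
  apps k (subst (a zero • θ) (lams k (bind v) M)) (a ∘ suc)
    ≈⟨ lams-β k (bind v) M (a zero • θ) (a ∘ suc) ⟩
  subst ([ a ∘ suc , a zero • θ ]′ ∘ bind v) M
    ≡⟨ subst-cong agree M ⟩
  subst ([ a , θ ]′ ∘ v) M ∎
  where
  agree : ∀ i → [ a ∘ suc , a zero • θ ]′ (bind v i) ≡ [ a , θ ]′ (v i)
  agree i with v i
  ... | inj₁ zero    = refl
  ... | inj₁ (suc j) = refl
  ... | inj₂ j       = refl

lams-inj₁-β : (M : Term k) (a : Fin k → Term 0) → apps k (lams k inj₁ M) a =βη subst a M
lams-inj₁-β {k} M a = begin
  apps k (lams k inj₁ M) a             ≡⟨ cong (λ L → apps k L a) (sym (subst-var _)) ⟩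
  apps k (subst var (lams k inj₁ M)) a ≈⟨ lams-β k inj₁ M var a ⟩
  subst a M                            ∎

-- Through k-fold abstraction this reduces to congruence of application.
subst-cong-=βη : (M : Term k) {σ σ′ : Fin k → Term 0} →
                 (∀ i → σ i =βη σ′ i) → subst σ M =βη subst σ′ M
subst-cong-=βη {k} M {σ} {σ′} e = begin
  subst σ M                 ≈⟨ lams-inj₁-β M σ ⟨
  apps k (lams k inj₁ M) σ  ≈⟨ apps-congʳ k e ⟩
  apps k (lams k inj₁ M) σ′ ≈⟨ lams-inj₁-β M σ′ ⟩
  subst σ′ M                ∎

subst-iterate : ∀ (σ : Fin m → Term n) (M N : Term m) k →
                subst σ (fold N (M ·_) k) ≡ fold (subst σ N) (subst σ M ·_) k
subst-iterate σ M N zero    = refl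
subst-iterate σ M N (suc k) = cong (subst σ M ·_) (subst-iterate σ M N k)

-- The numeral enters through an equation because under binders it appears as a repeated weakening,
-- which is only propositionally equal to `lift (ρ k)`.
numeral-β : ∀ k {N A B : Term n} → N ≡ lift (ρ k) → N · A · B =βη fold B (A ·_) k
numeral-β k {A = A} {B} refl = begin
  lift (ρ k) · A · B
    ≈⟨ ·-congˡ (β-• (λ ()) (ƛ iterated) A) ⟩
  (ƛ subst (exts (A • λ ())) iterated) · B
    ≈⟨ β-• (A • λ ()) iterated B ⟩
  subst (B • A • λ ()) iterated
    ≡⟨ subst-iterate (B • A • λ ()) (var (suc zero)) (var zero) k ⟩
  fold B (A ·_) k ∎
  where iterated = fold (var zero) (var (suc zero) ·_) k

-- Typing

⊢var-≡ : ∀ {Γ : Vec Type n} {i A} → lookup Γ i ≡ A → Γ ⊢ var i ∶ A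
⊢var-≡ refl = ⊢var _

⊢rename : ∀ {Γ : Vec Type m} {Δ : Vec Type n} {r M A} →
          (∀ i → lookup Δ (r i) ≡ lookup Γ i) → Γ ⊢ M ∶ A → Δ ⊢ rename r M ∶ A
⊢rename e (⊢var i) = ⊢var-≡ (e i)
⊢rename e (⊢ƛ d)   = ⊢ƛ (⊢rename (λ { zero → refl ; (suc i) → e i }) d)
⊢rename e (⊢· d d′) = ⊢· (⊢rename e d) (⊢rename e d′)

⊢subst : ∀ {Γ : Vec Type m} {Δ : Vec Type n} {σ M A} →
         (∀ i → Δ ⊢ σ i ∶ lookup Γ i) → Γ ⊢ M ∶ A → Δ ⊢ subst σ M ∶ A
⊢subst e (⊢var i)  = e i
⊢subst e (⊢ƛ d)    = ⊢ƛ (⊢subst (λ { zero → ⊢var zero ; (suc i) → ⊢rename (λ _ → refl) (e i) }) d)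
⊢subst e (⊢· d d′) = ⊢· (⊢subst e d) (⊢subst e d′)

⊢lift : ∀ {Γ : Vec Type n} {M A} → [] ⊢ M ∶ A → Γ ⊢ lift M ∶ A
⊢lift = ⊢subst λ ()

⊢apps : ∀ k {Γ : Vec Type n} {M a A C} → Γ ⊢ M ∶ A ^ k ⇒ C →
        (∀ i → Γ ⊢ a i ∶ A) → Γ ⊢ apps k M a ∶ C
⊢apps zero    d e = d
⊢apps (suc k) d e = ⊢apps k (⊢· d (e zero)) (e ∘ suc)

⊢lams : ∀ k {Γ : Vec Type n} {Δ : Vec Type m} {v : Fin m → Fin k ⊎ Fin n} {M A C} →
        (∀ i → lookup Δ i ≡ [ const A , lookup Γ ]′ (v i)) →
        Δ ⊢ M ∶ C → Γ ⊢ lams k v M ∶ A ^ k ⇒ C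
⊢lams zero {Γ} {Δ} {v} {A = A} e = ⊢rename λ i → agree i (e i)
  where
  agree : ∀ i → lookup Δ i ≡ [ const A , lookup Γ ]′ (v i) →
          lookup Γ ([ (λ ()) , (λ j → j) ]′ (v i)) ≡ lookup Δ i
  agree i e with v i
  ... | inj₂ j = sym e
⊢lams (suc k) {Γ} {Δ} {v} {A = A} e d = ⊢ƛ (⊢lams k (λ i → agree i (e i)) d)
  where
  agree : ∀ i → lookup Δ i ≡ [ const A , lookup Γ ]′ (v i) →
          lookup Δ i ≡ [ const A , lookup (A ∷ Γ) ]′ (bind v i)
  agree i e with v i
  ... | inj₁ zero    = e
  ... | inj₁ (suc j) = e
  ... | inj₂ j       = e

⊢ρ : ∀ k {A} → [] ⊢ ρ k ∶ ω A
⊢ρ k {A} = ⊢ƛ (⊢ƛ (body k))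
  where
  body : ∀ k → (A ∷ (A ⇒ A) ∷ []) ⊢ fold (var zero) (var (suc zero) ·_) k ∶ A
  body zero    = ⊢var zero
  body (suc k) = ⊢· (⊢var (suc zero)) (body k)

-- Definable functions

record Definable {k : ℕ} (s : ℕ) (f : Vec ℕ k → ℕ) : Set where
  constructor definable
  field
    term     : Term k
    computes : ∀ ns → subst (ρ ∘ lookup ns) term =βη ρ (f ns)
    typed    : replicate k (ω (τ s)) ⊢ term ∶ ω (τ s)

open Definable

definable-≗ : {f g : Vec ℕ k → ℕ} → f ≗ g → Definable s f → Definable s g
definable-≗ f≗g (definable M M-β ⊢M) =
  definable M (λ ns → M-β ns ◅◅ ≡⇒=βη (cong ρ (f≗g ns))) ⊢M

definable-compose : {f : Vec ℕ m → ℕ} {g : Fin m → Vec ℕ k → ℕ} →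
                    Definable s f → (∀ i → Definable s (g i)) → Definable s (compose f g)
definable-compose {m} {k} {s} {f} {g} (definable M M-β ⊢M) Gs =
  definable (subst G M) G-β (⊢subst ⊢G ⊢M)
  where
  G : Fin m → Term k
  G i = term (Gs i)

  ⊢G : ∀ i → replicate k (ω (τ s)) ⊢ G i ∶ lookup (replicate m (ω (τ s))) i
  ⊢G i rewrite lookup-replicate i (ω (τ s)) = typed (Gs i)

  G-β : ∀ ns → subst (ρ ∘ lookup ns) (subst G M) =βη ρ (compose f g ns)
  G-β ns = begin
    subst (ρ ∘ lookup ns) (subst G M)
      ≡⟨ subst-subst (ρ ∘ lookup ns) G M ⟩
    subst (subst (ρ ∘ lookup ns) ∘ G) M
      -- The terms put for the variables of `M` are only convertible to numerals, so they are
      -- replaced by actual numerals before `M-β` can apply.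
      ≈⟨ subst-cong-=βη M (λ i → computes (Gs i) ns ◅◅
           ≡⇒=βη (cong ρ (sym (lookup∘tabulate (λ j → g j ns) i)))) ⟩
    subst (ρ ∘ lookup (tabulate λ i → g i ns)) M
      ≈⟨ M-β (tabulate λ i → g i ns) ⟩
    ρ (compose f g ns) ∎

definable-const : ∀ c → Definable {k} s (const c)
definable-const c = definable (lift (ρ c))
  (λ ns → ≡⇒=βη (trans (subst-lift _ (ρ c)) (trans (subst-cong (λ ()) (ρ c)) (subst-var (ρ c)))))
  (⊢lift (⊢ρ c))

definable-proj : (i : Fin k) → Definable s (λ ns → lookup ns i)
definable-proj i = definable (var i) (λ ns → ε) (⊢var-≡ (lookup-replicate i _))

-- Addition and multiplication

definable-add : Definable s add
definable-add = definable (ƛ ƛ (m̂ · f · (n̂ · f · x))) add-β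
  (⊢ƛ (⊢ƛ (⊢· (⊢· (⊢var _) (⊢var _)) (⊢· (⊢· (⊢var _) (⊢var _)) (⊢var _)))))
  where
  x f m̂ n̂ : Term 4
  x = var zero
  f = var (suc zero)
  m̂ = var (suc (suc zero))
  n̂ = var (suc (suc (suc zero)))

  add-β : ∀ ns → subst (ρ ∘ lookup ns) (ƛ ƛ (m̂ · f · (n̂ · f · x))) =βη ρ (add ns)
  add-β (m ∷ n ∷ []) = ƛ-cong (ƛ-cong (begin
    _ ≈⟨ ·-congʳ (numeral-β n (weaken²-closed (ρ n))) ⟩
    _ ≈⟨ numeral-β m (weaken²-closed (ρ m)) ⟩
    _ ≡⟨ fold-+ (var zero) (var (suc zero) ·_) m ⟨
    _ ∎))

-- In the product, `A` is the second numeral applied to `F`. It acts as the n-th iterate of `F` only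
-- up to conversion, hence the hypothesis for every `X`.
iterate-* : ∀ m n {A F B : Term l} → (∀ X → A · X =βη fold X (F ·_) n) →
            fold B (A ·_) m =βη fold B (F ·_) (m * n)
iterate-* zero    n                 e = ε
iterate-* (suc m) n {A} {F} {B} e = begin
  A · fold B (A ·_) m                      ≈⟨ ·-congʳ (iterate-* m n e) ⟩
  A · fold B (F ·_) (m * n)                ≈⟨ e _ ⟩
  fold (fold B (F ·_) (m * n)) (F ·_) n    ≡⟨ fold-+ B (F ·_) n ⟨
  fold B (F ·_) (n + m * n)                ∎

definable-mul : Definable s mul
definable-mul = definable (ƛ ƛ (m̂ · (n̂ · f) · x)) mul-β
  (⊢ƛ (⊢ƛ (⊢· (⊢· (⊢var _) (⊢· (⊢var _) (⊢var _))) (⊢var _))))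
  where
  x f m̂ n̂ : Term 4
  x = var zero
  f = var (suc zero)
  m̂ = var (suc (suc zero))
  n̂ = var (suc (suc (suc zero)))

  mul-β : ∀ ns → subst (ρ ∘ lookup ns) (ƛ ƛ (m̂ · (n̂ · f) · x)) =βη ρ (mul ns)
  mul-β (m ∷ n ∷ []) = ƛ-cong (ƛ-cong (
    numeral-β m (weaken²-closed (ρ m)) ◅◅
    iterate-* m n (λ X → numeral-β n (weaken²-closed (ρ n)))))

-- Tuples of numerals

-- The Church encoding: a tuple hands all its entries to a continuation.
tuple : (Fin s → ℕ) → Term 0
tuple {s} w = ƛ apps s (var zero) (λ i → lift (ρ (w i)))

⊢tuple : (w : Fin s → ℕ) → [] ⊢ tuple w ∶ τ s
⊢tuple {s} w = ⊢ƛ (⊢apps s (⊢var zero) (λ i → ⊢lift (⊢ρ (w i))))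

tuple-β : (w : Fin s → ℕ) (L : Term n) →
          lift (tuple w) · L =βη apps s L (λ i → lift (ρ (w i)))
tuple-β {s} w L = begin
  lift (tuple w) · L
    ≈⟨ β-• (λ ()) (apps s (var zero) (λ i → lift (ρ (w i)))) L ⟩
  subst (L • λ ()) (apps s (var zero) (λ i → lift (ρ (w i))))
    ≡⟨ subst-apps s (L • λ ()) (var zero) (λ i → lift (ρ (w i))) ⟩
  apps s L (λ i → subst (L • λ ()) (lift (ρ (w i))))
    ≈⟨ apps-congʳ s (λ i → ≡⇒=βη (subst-lift (L • λ ()) (ρ (w i)))) ⟩
  apps s L (λ i → lift (ρ (w i))) ∎

-- The body is always a continuation applied to s variables in order. The rearrangement lies only in
-- which abstraction binds each variable, so `δ` may repeat or drop entries.
reindexVar : (Fin s → Fin s) → Fin (suc s) → Fin s ⊎ Fin 2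
reindexVar δ zero    = inj₂ zero
reindexVar δ (suc i) = inj₁ (δ i)

reindex : (Fin s → Fin s) → Term 0
reindex {s} δ = ƛ ƛ (var (suc zero) · lams s (reindexVar δ) (apps s (var zero) (var ∘ suc)))

⊢reindex : (δ : Fin s → Fin s) → [] ⊢ reindex δ ∶ τ s ⇒ τ s
⊢reindex {s} δ = ⊢ƛ (⊢ƛ (⊢· (⊢var (suc zero))
  (⊢lams s {Δ = (α ^ s ⇒ α) ∷ replicate s α}
    (λ { zero → refl ; (suc i) → lookup-replicate i α })
    (⊢apps s (⊢var zero) (λ i → ⊢var-≡ (lookup-replicate i α))))))

-- The old tuple feeds its entries to the rearranging function, which passes entry `δ i` on to the
-- new continuation at position `i`.
reindex-β : (δ : Fin s → Fin s) {w w′ : Fin s → ℕ} → (∀ i → w′ i ≡ w (δ i)) →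
            lift {n} (reindex δ) · lift (tuple w) =βη lift (tuple w′)
reindex-β {s} {n} δ {w} {w′} e = begin
  lift (reindex δ) · lift (tuple w)
    ≈⟨ β-• (λ ()) (ƛ (var (suc zero) · rearranged)) (lift (tuple w)) ⟩
  ƛ (weaken (lift (tuple w)) · subst θ rearranged)
    ≡⟨ cong (λ T → ƛ (T · subst θ rearranged)) (rename-lift suc (tuple w)) ⟩
  ƛ (lift (tuple w) · subst θ rearranged)
    ≈⟨ ƛ-cong (tuple-β w (subst θ rearranged)) ⟩
  ƛ apps s (subst θ rearranged) entries
    ≈⟨ ƛ-cong (lams-β s (reindexVar δ) (apps s (var zero) (var ∘ suc)) θ entries) ⟩
  ƛ subst ([ entries , θ ]′ ∘ reindexVar δ) (apps s (var zero) (var ∘ suc))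
    ≡⟨ cong ƛ_ (subst-apps s ([ entries , θ ]′ ∘ reindexVar δ) (var zero) (var ∘ suc)) ⟩
  ƛ apps s (var zero) (entries ∘ δ)
    -- `lift (tuple w′)` computes to an abstraction whose body carries the substitution `exts λ ()`,
    -- so the entries are brought to that form.
    ≈⟨ ƛ-cong (apps-congʳ s λ i → ≡⇒=βη (trans
         (cong (lift ∘ ρ) (sym (e i))) (sym (subst-lift (exts λ ()) (ρ (w′ i)))))) ⟩
  ƛ apps s (var zero) (λ i → subst (exts λ ()) (lift (ρ (w′ i))))
    ≡⟨ cong ƛ_ (subst-apps s (exts λ ()) (var zero) (λ i → lift (ρ (w′ i)))) ⟨
  lift (tuple w′) ∎
  where
  rearranged : Term 2
  rearranged = lams s (reindexVar δ) (apps s (var zero) (var ∘ suc))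

  θ : Fin 2 → Term (suc n)
  θ = exts (lift (tuple w) • λ ())

  entries : Fin s → Term (suc n)
  entries i = lift (ρ (w i))

iterate-reindex : (δ : Fin s → Fin s) (w : ℕ → Fin s → ℕ) →
                  (∀ m i → w (suc m) i ≡ w m (δ i)) → ∀ m →
                  fold (lift {n} (tuple (w 0))) (lift (reindex δ) ·_) m =βη lift (tuple (w m))
iterate-reindex δ w e zero    = ε
iterate-reindex δ w e (suc m) = ·-congʳ (iterate-reindex δ w e m) ◅◅ reindex-β δ {w m} {w (suc m)} (e m)

-- Branching

-- Five arguments take a term of type `ω (τ s)` down to `o`: two for the outer `ω`, a continuation
-- for `τ s`, and two for `α`.
ηexpansion₅ : Term n → Term (5 + n)
ηexpansion₅ N =
  weaken (weaken (weaken (weaken (weaken N)))) · var (suc (suc (suc (suc zero)))) ·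
    var (suc (suc (suc zero))) · var (suc (suc zero)) · var (suc zero) · var zero

η₅ : (N : Term n) → ƛ ƛ ƛ ƛ ƛ ηexpansion₅ N =βη N
η₅ N = ƛ-cong (ƛ-cong (ƛ-cong (ƛ-cong (step η)))) ◅◅ ƛ-cong (ƛ-cong (ƛ-cong (step η)))
   ◅◅ ƛ-cong (ƛ-cong (step η)) ◅◅ ƛ-cong (step η) ◅◅ step η

-- The numeral iterates a constant function from `B`: no iteration leaves `B`, and the outermost of
-- several discards all the others.
ifzero-β : ∀ c {N A B : Term n} → N ≡ lift (ρ c) →
           N · (ƛ weaken A) · B =βη (if c ≤ᵇ 0 then B else A)
ifzero-β zero    e = numeral-β 0 e
ifzero-β (suc c) {A = A} e = numeral-β (suc c) e ◅◅ step β ◅◅ ≡⇒=βη (weaken-[] A _)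

branch : (ℕ → ℕ) → Vec ℕ 3 → ℕ
branch p (m ∷ a ∷ b ∷ []) = ifzero (p m ∷ a ∷ b ∷ [])

-- At type `ω (τ s)` the argument `m` can iterate `reindex δ` on tuples. Three of the five
-- η-arguments are abstracted outside the tuple; the other two are abstracted in the continuation,
-- whose result must have type `α`.
definable-branch-tuple : (δ : Fin s → Fin s) (w : ℕ → Fin s → ℕ) →
  (∀ m i → w (suc m) i ≡ w m (δ i)) → (q : Fin s) → Definable s (branch λ m → w m q)
definable-branch-tuple {s} δ w e q = definable M M-β ⊢M
  where
  -- The variables of the body are the entry q, then g, x, f, m, a, b.
  v : Fin 7 → Fin s ⊎ Fin 6
  v zero    = inj₁ q
  v (suc i) = inj₂ i

  choice : Term 7
  -- The entry is applied as in `ifzero-β`: the constant function returns the second branch, and the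
  -- starting value is the first, taken when the entry is zero.
  choice = ƛ ƛ (var (suc (suc zero)) · (ƛ weaken (branch′ b̂)) · branch′ â)
    where
    â b̂ : Fin 9
    â = suc (suc (suc (suc (suc (suc (suc zero))))))
    b̂ = suc (suc (suc (suc (suc (suc (suc (suc zero)))))))

    branch′ : Fin 9 → Term 9
    branch′ i = var i · var (suc (suc (suc (suc (suc zero))))) ·
      var (suc (suc (suc (suc zero)))) · var (suc (suc (suc zero))) · var (suc zero) · var zero

  M : Term 3
  M = ƛ ƛ ƛ (var (suc (suc (suc zero))) · lift (reindex δ) · lift (tuple (w 0)) · lams s v choice)

  ⊢M : replicate 3 (ω (τ s)) ⊢ M ∶ ω (τ s)
  ⊢M = ⊢ƛ (⊢ƛ (⊢ƛ (⊢·
    (⊢· (⊢· (⊢var _) (⊢lift (⊢reindex δ))) (⊢lift (⊢tuple (w 0))))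
    (⊢lams s {Δ = α ∷ (α ^ s ⇒ α) ∷ τ s ∷ (τ s ⇒ τ s) ∷ replicate 3 (ω (τ s))}
      (λ { zero → refl ; (suc i) → refl })
      (⊢ƛ (⊢ƛ (⊢· (⊢· (⊢var _) (⊢ƛ (⊢five (⊢var _) (⊢var _) (⊢var _) (⊢var _) (⊢var _) (⊢var _))))
                 (⊢five (⊢var _) (⊢var _) (⊢var _) (⊢var _) (⊢var _) (⊢var _)))))))))
    where
    ⊢five : ∀ {n} {Γ : Vec Type n} {N N₁ N₂ N₃ N₄ N₅ A₁ A₂ A₃ A₄ A₅ C} →
      Γ ⊢ N ∶ A₁ ⇒ A₂ ⇒ A₃ ⇒ A₄ ⇒ A₅ ⇒ C →
      Γ ⊢ N₁ ∶ A₁ → Γ ⊢ N₂ ∶ A₂ → Γ ⊢ N₃ ∶ A₃ → Γ ⊢ N₄ ∶ A₄ → Γ ⊢ N₅ ∶ A₅ →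
      Γ ⊢ N · N₁ · N₂ · N₃ · N₄ · N₅ ∶ C
    ⊢five d d₁ d₂ d₃ d₄ d₅ = ⊢· (⊢· (⊢· (⊢· (⊢· d d₁) d₂) d₃) d₄) d₅

  select : ∀ c a b → ƛ ƛ ƛ ƛ ƛ (if c ≤ᵇ 0 then ηexpansion₅ (ρ a) else ηexpansion₅ (ρ b))
           =βη ρ (ifzero (c ∷ a ∷ b ∷ []))
  select zero    a b = η₅ (ρ a)
  select (suc c) a b = η₅ (ρ b)

  M-β : ∀ ns → subst (ρ ∘ lookup ns) M =βη ρ (branch (λ m → w m q) ns)
  M-β (m ∷ a ∷ b ∷ []) = begin
    _ ≈⟨ ƛ-cong (ƛ-cong (ƛ-cong (begin
         weaken (weaken (weaken (ρ m))) · subst θ (lift (reindex δ)) · subst θ (lift (tuple (w 0))) · L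
           ≡⟨ cong₂ (λ R T → weaken (weaken (weaken (ρ m))) · R · T · L)
                (subst-lift θ (reindex δ)) (subst-lift θ (tuple (w 0))) ⟩
         weaken (weaken (weaken (ρ m))) · lift (reindex δ) · lift (tuple (w 0)) · L
           ≈⟨ ·-congˡ (numeral-β m (weaken³-closed (ρ m))) ⟩
         fold (lift (tuple (w 0))) (lift (reindex δ) ·_) m · L
           ≈⟨ ·-congˡ (iterate-reindex δ w e m) ⟩
         lift (tuple (w m)) · L
           ≈⟨ tuple-β (w m) L ⟩
         apps s L (λ i → lift (ρ (w m i)))
           ≈⟨ lams-β s v choice θ (λ i → lift (ρ (w m i))) ⟩
         subst ([ (λ i → lift (ρ (w m i))) , θ ]′ ∘ v) choice
           -- Both branches already compute to the η-expansions of `ρ a` and `ρ b`; only the twice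
           -- weakened entry has to be rewritten as a lifted numeral.
           ≈⟨ ƛ-cong (ƛ-cong (ifzero-β (w m q) (trans
                (cong weaken (rename-lift suc (ρ (w m q)))) (rename-lift suc (ρ (w m q)))))) ⟩
         ƛ ƛ (if w m q ≤ᵇ 0 then ηexpansion₅ (ρ a) else ηexpansion₅ (ρ b)) ∎))) ⟩
    _ ≈⟨ select (w m q) a b ⟩
    _ ∎
    where
    θ : Fin 6 → Term 3
    θ = exts (exts (exts (ρ ∘ lookup (m ∷ a ∷ b ∷ []))))

    L : Term 3
    L = subst θ (lams s v choice)

definable-branch : ∀ (p : ℕ → ℕ) preperiod period → 1 ≤ period →
  (∀ n → preperiod ≤ n → p (period + n) ≡ p n) →
  preperiod + period ≤ s → Definable s (branch p)
definable-branch {s} p N P 1≤P periodic N+P≤s =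
  definable-≗ from-0 (definable-branch-tuple δ (λ m i → p (toℕ i + m)) shift (fromℕ< 0<s))
  where
  P≤s : P ≤ s
  P≤s = ≤-trans (m≤n+m P N) N+P≤s

  0<s : 0 < s
  0<s = ≤-trans 1≤P P≤s

  c<s : s ∸ P < s
  c<s = ∸-monoʳ-< 1≤P P≤s

  -- Position `s ∸ P` lies one period before the end. The bound on `s` puts it past the preperiod,
  -- so `periodic` applies there at every shift `m`.
  N≤c : N ≤ s ∸ P
  N≤c = m+n≤o⇒m≤o∸n N N+P≤s

  δ : Fin s → Fin s
  δ i with suc (toℕ i) <? s
  ... | yes i+1<s = fromℕ< i+1<s
  ... | no  _     = fromℕ< c<s

  shift : ∀ m i → p (toℕ i + suc m) ≡ p (toℕ (δ i) + m)
  shift m i with suc (toℕ i) <? s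
  ... | yes i+1<s rewrite toℕ-fromℕ< i+1<s = cong p (+-suc (toℕ i) m)
  ... | no  i+1≮s rewrite toℕ-fromℕ< c<s = wrap
    where
    i+1≡s : suc (toℕ i) ≡ s
    i+1≡s = ≤-antisym (toℕ<n i) (≮⇒≥ i+1≮s)

    -- Here `i` is the last position, so the value shifted in is `p (s + m)`; writing `s` as
    -- `P + (s ∸ P)` exposes the period.
    wrap : p (toℕ i + suc m) ≡ p (s ∸ P + m)
    wrap = trans
      (cong p (trans (+-suc (toℕ i) m) (trans
        (cong (_+ m) (trans i+1≡s (sym (m+[n∸m]≡n P≤s)))) (+-assoc P (s ∸ P) m))))
      (periodic (s ∸ P + m) (≤-trans N≤c (m≤m+n (s ∸ P) m)))

  from-0 : branch (λ m → p (toℕ (fromℕ< 0<s) + m)) ≗ branch p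
  from-0 (m ∷ a ∷ b ∷ []) rewrite toℕ-fromℕ< 0<s = refl

-- The class 𝒢

-- The test is constant from `suc l` on: preperiod `suc l`, period 1. It yields 0 for true since
-- `branch` takes its first alternative at 0.
definable-threshold : ∀ l → suc l + 1 ≤ s → Definable s (f₂ l)
definable-threshold l l+2≤s = definable-≗ agree
  (definable-branch p (suc l) 1 (s≤s z≤n) periodic l+2≤s)
  where
  p : ℕ → ℕ
  p m = if m ≤ᵇ l then 0 else 1

  p≡1 : ∀ n → l < n → p n ≡ 1
  p≡1 n l<n with n ≤ᵇ l in eq
  ... | false = refl
  ... | true  = contradiction (≤ᵇ⇒≤ n l (≡.subst T (sym eq) _)) (<⇒≱ l<n)

  periodic : ∀ n → l < n → p (suc n) ≡ p n
  periodic n l<n = trans (p≡1 (suc n) (m<n⇒m<1+n l<n)) (sym (p≡1 n l<n))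

  agree : branch p ≗ f₂ l
  agree (m ∷ a ∷ b ∷ []) with m ≤ᵇ l
  ... | true  = refl
  ... | false = refl

-- Being zero is being at most 0, so this is the threshold at `l = 0`, whose bound `suc l + 1` is 2.
definable-ifzero : 2 ≤ s → Definable s ifzero
definable-ifzero 2≤s = definable-≗
  (λ { (zero ∷ a ∷ b ∷ []) → refl ; (suc m ∷ a ∷ b ∷ []) → refl }) (definable-threshold 0 2≤s)

-- Selection by residue

module _ (l : ℕ) .{{_ : NonZero l}} where

  test : Fin l → ℕ → ℕ
  test i m = if does (m mod l ≟ i) then 0 else 1

  mod-periodic : ∀ n → (l + n) mod l ≡ n mod l
  mod-periodic n = fromℕ<-cong _ _ (trans (cong (_% l) (+-comm l n)) ([m+n]%n≡m%n n l)) _ _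

  -- Selection among `l` values becomes a cascade of two-way branches, one per residue. The default
  -- 0 is never reached when the list contains the residue of `m`, as `allFin l` does.
  pick : List (Fin l) → Vec ℕ (suc l) → ℕ
  pick []       ns = 0
  pick (i ∷ is) ns = branch (test i) (lookup ns zero ∷ lookup ns (suc i) ∷ pick is ns ∷ [])

  definable-pick : l ≤ s → ∀ is → Definable s (pick is)
  definable-pick l≤s []       = definable-const 0
  definable-pick l≤s (i ∷ is) = definable-compose
    -- Spelled out so that tabulating these functions computes to the vector in the definition of
    -- `pick`.
    {g = λ { zero ns             → lookup ns zero
           ; (suc zero) ns       → lookup ns (suc i)
           ; (suc (suc zero)) ns → pick is ns }}
    (definable-branch (test i) 0 l (n≢0⇒n>0 (≢-nonZero⁻¹ l))
      (λ n _ → cong (λ j → if does (j ≟ i) then 0 else 1) (mod-periodic n)) l≤s)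
    λ { zero             → definable-proj zero
      ; (suc zero)       → definable-proj (suc i)
      ; (suc (suc zero)) → definable-pick l≤s is }

  pick-∈ : ∀ m ns is → m mod l ∈ is → pick is (m ∷ ns) ≡ lookup ns (m mod l)
  pick-∈ m ns (i ∷ is) i∈ with m mod l ≟ i
  pick-∈ m ns (i ∷ is) _          | yes eq = cong (lookup ns) (sym eq)
  pick-∈ m ns (i ∷ is) (here eq)  | no neq = contradiction eq neq
  pick-∈ m ns (i ∷ is) (there i∈) | no neq = pick-∈ m ns is i∈

definable-residue : ∀ l .{{_ : NonTrivial l}} → l ≤ s → Definable s (f₁ l)
definable-residue l l≤s = definable-≗
  (λ { (m ∷ ns) → pick-∈ l m ns (allFin l) (∈-allFin (m mod l)) })
  (definable-pick l l≤s (allFin l))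
  where instance _ = nonTrivial⇒nonZero l

-- Definability for all large s

Eventually : (ℕ → Set) → Set
Eventually P = Σ[ N ∈ ℕ ] (∀ s → N ≤ s → P s)

-- Finitely many bounds have a maximum. This lets a composition, with its finitely many inner
-- functions, keep a single bound on `s`.
eventually-∀ : {P : Fin m → ℕ → Set} → (∀ i → Eventually (P i)) → Eventually λ s → ∀ i → P i s
eventually-∀ {zero}  e = 0 , λ s _ ()
eventually-∀ {suc m} e with e zero | eventually-∀ (e ∘ suc)
... | N , e₀ | N′ , e₊ = N ⊔ N′ , λ s N⊔N′≤s →
  λ { zero    → e₀ s (m⊔n≤o⇒m≤o N N′ N⊔N′≤s)
    ; (suc i) → e₊ s (m⊔n≤o⇒n≤o N N′ N⊔N′≤s) i }

eventually-compose : {f : Vec ℕ m → ℕ} {g : Fin m → Vec ℕ k → ℕ} →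
  Eventually (λ s → Definable s f) → (∀ i → Eventually λ s → Definable s (g i)) →
  Eventually λ s → Definable s (compose f g)
eventually-compose (N , F) Gs with eventually-∀ Gs
... | N′ , G = N ⊔ N′ , λ s N⊔N′≤s →
  definable-compose (F s (m⊔n≤o⇒m≤o N N′ N⊔N′≤s)) (G s (m⊔n≤o⇒n≤o N N′ N⊔N′≤s))

eventually-extendedPolynomial : {f : Vec ℕ k → ℕ} → ExtendedPolynomial f →
                                Eventually λ s → Definable s f
eventually-extendedPolynomial const-0           = 0 , λ _ _ → definable-const 0
eventually-extendedPolynomial const-1           = 0 , λ _ _ → definable-const 1
eventually-extendedPolynomial (proj i)          = 0 , λ _ _ → definable-proj i
eventually-extendedPolynomial addition          = 0 , λ _ _ → definable-add
eventually-extendedPolynomial multiplication    = 0 , λ _ _ → definable-mul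
eventually-extendedPolynomial conditional       = 2 , λ _ → definable-ifzero
eventually-extendedPolynomial (composition F G) = eventually-compose
  (eventually-extendedPolynomial F) (λ i → eventually-extendedPolynomial (G i))
eventually-extendedPolynomial (≗-closed f≗g F) with eventually-extendedPolynomial F
... | N , F′ = N , λ s N≤s → definable-≗ f≗g (F′ s N≤s)

eventually-𝒢 : {f : Vec ℕ k → ℕ} → 𝒢 f → Eventually λ s → Definable s f
eventually-𝒢 (extendedPolynomial F) = eventually-extendedPolynomial F
eventually-𝒢 (residue l)            = l , λ _ → definable-residue l
eventually-𝒢 (threshold l _)        = suc l + 1 , λ _ → definable-threshold l
eventually-𝒢 (composition F G)      = eventually-compose (eventually-𝒢 F) (λ i → eventually-𝒢 (G i))
eventually-𝒢 (≗-closed f≗g F) with eventually-𝒢 F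
... | N , F′ = N , λ s N≤s → definable-≗ f≗g (F′ s N≤s)

theorem1 : ∀ (k : ℕ) (f : Vec ℕ k → ℕ) → 𝒢 f →
    Σ[ exceptions ∈ List ℕ ] (∀ (s : ℕ) → 1 ≤ s → s ∉ exceptions →
    Σ[ E ∈ Term 0 ]
    ((∀ (ns : Vec ℕ k) → (E ·* map ρ ns) =βη ρ (f ns)) ×
    ([] ⊢ E ∶ (ω (τ s) ^ k ⇒ ω (τ s)))))
theorem1 k f f∈𝒢 with eventually-𝒢 f∈𝒢
-- The exceptions are the numbers below `N`, so any `s` outside the list satisfies `N ≤ s`.
... | N , F = upTo N , λ s _ s∉ → close (F s (≮⇒≥ (s∉ ∘ ∈-upTo⁺)))
  where
  close : ∀ {s} → Definable s f → Σ[ E ∈ Term 0 ]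
    ((∀ (ns : Vec ℕ k) → (E ·* map ρ ns) =βη ρ (f ns)) × ([] ⊢ E ∶ (ω (τ s) ^ k ⇒ ω (τ s))))
  -- With `inj₁`, variable `i` is bound by the i-th abstraction from the outside, which matches the
  -- order of the arguments.
  close (definable M M-β ⊢M) = lams k inj₁ M , closed-β , ⊢lams k (λ i → lookup-replicate i _) ⊢M
    where
    closed-β : ∀ ns → (lams k inj₁ M ·* map ρ ns) =βη ρ (f ns)
    closed-β ns = begin
      lams k inj₁ M ·* map ρ ns                  ≡⟨ ·*≡apps _ (map ρ ns) ⟩
      apps k (lams k inj₁ M) (lookup (map ρ ns)) ≈⟨ lams-inj₁-β M (lookup (map ρ ns)) ⟩
      subst (lookup (map ρ ns)) M                ≡⟨ subst-cong (λ i → lookup-map i ρ ns) M ⟩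
      subst (ρ ∘ lookup ns) M                    ≈⟨ M-β ns ⟩
      ρ (f ns)                                   ∎
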